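{- Let $k\ge 2$ be an integer, and let $\alpha=(k-1)(k-2)\cdots 1\,0$ be the word of length $k$ obtained by concatenating each letter of $\Sigma_k$ once in decreasing order. For every integer $n>0$, the word $\alpha^n$ is a BWT image if and only if $kn+1$ is prime and $k$ is a primitive root modulo $kn+1$.
   Context: $\Sigma_k=\{0,1,\ldots,k-1\}$ with the usual order. For a word $w$, $w^n$ is the concatenation of $n$ copies of $w$. The shift of a word $w=w_0\cdots w_{m-1}$ is $w_{m-1}w_0\cdots w_{m-2}$. A necklace $[w]$ is an equivalence class of words under iterated shift. The Burrows--Wheeler Transform (BWT) of a necklace $[w]$ is the word given by the last column, read top to bottom, of the matrix whose rows are the $|w|$ shifts of $w$ (counted with multiplicity) sorted in ascending lexicographic order. A word is a BWT image if it is the BWT of some necklace. For a prime $p$, an integer $a$ is a primitive root modulo $p$ if $a$ generates the multiplicative group $\mathbb{Z}_p^*$, i.e. $\{a^i \bmod p \mid i\in\mathbb{Z}\}=\{1,\dots,p-1\}$. -}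

module Defs where

open import Data.Fin.Base using (Fin)
import Data.Fin.Properties as Fin
open import Data.Integer.Base using (ℤ; +_; -[1+_])
open import Data.List.Base
  using (List; []; _∷_; _∷ʳ_; _++_; allFin; concat; initLast; _∷ʳ′_; iterate;
         last; length; mapMaybe; replicate; reverse)
open import Data.List.Properties
  using (++-assoc; ++-identityʳ; length-++; ∷ʳ-++; ∷ʳ-injective)
open import Data.List.Relation.Binary.Lex.NonStrict using (≤-decTotalOrder)
open import Data.List.Relation.Binary.Permutation.Homogeneous as Homogeneous using ()
open import Data.List.Relation.Binary.Permutation.Propositional
  using (_↭_; ↭-sym; ↭-trans; ↭-reflexive; ↭⇒↭ₛ)
open import Data.List.Relation.Binary.Permutation.Propositional.Properties
  using (drop-∷; ∷↭∷ʳ)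
open import Data.List.Relation.Binary.Pointwise as Pointwise using (Pointwise-≡⇒≡)
open import Data.List.Relation.Unary.Sorted.TotalOrder.Properties using (↗↭↗⇒≋)
open import Data.List.Reverse using (Reverse; reverseView; []; _∶_∶ʳ_)
open import Data.List.Sort as Sort using ()
open import Data.Nat.Base using (ℕ; zero; suc; _*_; _^_; _≤_; _<_; NonZero)
open import Data.Nat.DivMod using (_%_)
open import Data.Nat.GeneralisedArithmetic using () renaming (iterate to iter)
open import Data.Nat.Primality using (Prime; prime⇒nonZero)
open import Data.Nat.Properties using (+-comm)
open import Data.Product.Base using (_×_; _,_; ∃-syntax)
open import Function.Bundles using (Func; _⟨$⟩_; _⇔_)
open import Relation.Binary.Bundles using (DecTotalOrder; Setoid)
open import Relation.Binary.Construct.Closure.Equivalence as EqClosure using ()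
open import Relation.Binary.PropositionalEquality
  using (_≡_; refl; sym; trans; cong; isEquivalence; setoid; module ≡-Reasoning)

Word : ℕ → Set
Word k = List (Fin k)

infixr 8 _^ʷ_

_^ʷ_ : ∀ {k} → Word k → ℕ → Word k
w ^ʷ n = concat (replicate n w)

α : ∀ k → Word k
α k = reverse (allFin k)

shift : ∀ {k} → Word k → Word k
shift w with initLast w
... | []      = []
... | u ∷ʳ′ x = x ∷ u

shifts : ∀ {k} → Word k → List (Word k)
shifts w = iterate shift w (length w)

lexOrder : ∀ k → DecTotalOrder _ _ _
lexOrder k = ≤-decTotalOrder (Fin.≤-decTotalOrder k)

sortWords : ∀ {k} → List (Word k) → List (Word k)
sortWords {k} = Sort.sort (lexOrder k)

-- `mapMaybe` discards nothing here: a nonempty w has only nonempty shifts,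
-- and the matrix of the empty word has no rows.
bwt : ∀ {k} → Word k → Word k
bwt w = mapMaybe last (sortWords (shifts w))

Necklace : ∀ k → Setoid _ _
Necklace k = EqClosure.setoid {A = Word k} (λ v w → shift v ≡ w)

shift-∷ʳ : ∀ {k} (u : Word k) x → shift (u ∷ʳ x) ≡ x ∷ u
shift-∷ʳ u x = go u refl
  where
  go : ∀ {v} u → v ≡ u ∷ʳ x → shift v ≡ x ∷ u
  go {v} u eq with initLast v
  go []      () | []
  go (_ ∷ _) () | []
  go u       eq | u′ ∷ʳ′ x′ with refl , refl ← ∷ʳ-injective u′ u eq = refl

shift-length-++ : ∀ {k} (u v : Word k) → iter shift (u ++ v) (length v) ≡ v ++ u
shift-length-++ u v = go u (reverseView v)
  where
  open ≡-Reasoning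
  go : ∀ u {v} → Reverse v → iter shift (u ++ v) (length v) ≡ v ++ u
  go u []             = ++-identityʳ u
  go u (v ∶ rv ∶ʳ x) = begin
    iter shift (u ++ v ∷ʳ x) (length (v ∷ʳ x))
      ≡⟨ cong (iter shift _) (trans (length-++ v) (+-comm (length v) 1)) ⟩
    iter shift (shift (u ++ v ∷ʳ x)) (length v)
      ≡⟨ cong (λ w → iter shift (shift w) (length v)) (++-assoc u v _) ⟨
    iter shift (shift ((u ++ v) ∷ʳ x)) (length v)
      ≡⟨ cong (λ w → iter shift w (length v)) (shift-∷ʳ (u ++ v) x) ⟩
    iter shift (x ∷ u ++ v) (length v)
      ≡⟨ go (x ∷ u) rv ⟩
    v ++ x ∷ u
      ≡⟨ ∷ʳ-++ v x u ⟨
    v ∷ʳ x ++ u ∎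

shift-length : ∀ {k} (w : Word k) → iter shift w (length w) ≡ w
shift-length w = trans (shift-length-++ [] w) (++-identityʳ w)

length-shift : ∀ {k} (w : Word k) → length (shift w) ≡ length w
length-shift w with initLast w
... | []      = refl
... | u ∷ʳ′ x = sym (trans (length-++ u) (+-comm (length u) 1))

iterate-∷ʳ : ∀ {A : Set} (f : A → A) x n →
             x ∷ iterate f (f x) n ≡ iterate f x n ∷ʳ iter f x n
iterate-∷ʳ f x zero    = refl
iterate-∷ʳ f x (suc n) = cong (x ∷_) (iterate-∷ʳ f (f x) n)

shifts-shift : ∀ {k} (w : Word k) → shifts (shift w) ↭ shifts w
shifts-shift w = drop-∷ (↭-trans (↭-reflexive eq) (↭-sym (∷↭∷ʳ w (shifts w))))
  where
  open ≡-Reasoning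
  eq : w ∷ shifts (shift w) ≡ shifts w ∷ʳ w
  eq = begin
    w ∷ shifts (shift w)
      ≡⟨ cong (λ n → w ∷ iterate shift (shift w) n) (length-shift w) ⟩
    w ∷ iterate shift (shift w) (length w)
      ≡⟨ iterate-∷ʳ shift w (length w) ⟩
    shifts w ∷ʳ iter shift w (length w)
      ≡⟨ cong (shifts w ∷ʳ_) (shift-length w) ⟩
    shifts w ∷ʳ w ∎

sortWords-cong : ∀ {k} {us vs : List (Word k)} → us ↭ vs → sortWords us ≡ sortWords vs
sortWords-cong {k} {us} {vs} us↭vs =
  Pointwise-≡⇒≡ (Pointwise.map Pointwise-≡⇒≡
    (↗↭↗⇒≋ totalOrder (sort-↗ us) (sort-↗ vs) (Homogeneous.map Eq.reflexive (↭⇒↭ₛ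
      (↭-trans (sort-↭ us) (↭-trans us↭vs (↭-sym (sort-↭ vs))))))))
  where
  open DecTotalOrder (lexOrder k) using (totalOrder; module Eq)
  open Sort (lexOrder k) using (sort-↭; sort-↗)

bwt-shift : ∀ {k} (w : Word k) → bwt w ≡ bwt (shift w)
bwt-shift w = cong (mapMaybe last) (sortWords-cong (↭-sym (shifts-shift w)))

BWT : ∀ {k} → Func (Necklace k) (setoid (Word k))
BWT = record
  { to   = bwt
  ; cong = EqClosure.gfold isEquivalence bwt λ { {v} refl → bwt-shift v }
  }

IsBWTImage : ∀ {k} → Word k → Set
IsBWTImage u = ∃[ w ] BWT ⟨$⟩ w ≡ u

-- `IsPower p a i x` says that x, as a residue in {0, …, p − 1}, is aⁱ mod p.
-- For i < 0, aⁱ is the inverse of a^∣i∣ modulo p, so that no x qualifies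
-- when a is not invertible.
IsPower : (p : ℕ) .{{_ : NonZero p}} → ℕ → ℤ → ℕ → Set
IsPower p a (+ i)    x = (a ^ i) % p ≡ x
IsPower p a -[1+ i ] x = x < p × (x * a ^ suc i) % p ≡ 1 % p

-- {aⁱ mod p ∣ i ∈ ℤ} = {1, …, p − 1}
IsPrimitiveRoot : (p : ℕ) → Prime p → ℕ → Set
IsPrimitiveRoot p p-prime a =
  ∀ x → (∃[ i ] IsPower p {{prime⇒nonZero p-prime}} a i x) ⇔ (1 ≤ x × x < p)

{-# OPTIONS --safe #-}

-- Write N = kn and p = N + 1, index the rows of a sorted matrix by i < N, and
-- let row i stand for the residue i + 1 modulo p. The rows of a matrix with
-- last column αⁿ satisfy row i = shift (row (s i)), where s is the inverse of
-- the standard permutation of αⁿ: sorting the shifted rows stably by their new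
-- first letter gives back the matrix. Since k·n ≡ −1 (mod p), the map s is
-- multiplication by k modulo p, and the first letter of row i is the quotient
-- of k(i + 1) by p, so row i is the base-k period of (i + 1)/p. Adjacent
-- letters of αⁿ differ, so all rows are distinct, and as they form a single
-- necklace, s is transitive: every residue 1, …, p − 1 is a power of k, which
-- also forces p to be prime. Conversely, if k is a primitive root modulo p, the
-- necklace of the base-k period of 1/p has the base-k periods of x/p,
-- 1 ≤ x < p, as its sorted rows.
module Submission where

open import Defs
open import Data.Fin.Base as Fin using (Fin; toℕ; fromℕ<)
import Data.Fin.Properties as Fin
import Data.Integer.Base as ℤ
open import Data.List.Base
  using (List; []; _∷_; _∷ʳ_; _++_; allFin; applyUpTo; downFrom; initLast; _∷ʳ′_;
         iterate; last; length; map; mapMaybe; reverse; tabulate; upTo)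
open import Data.List.Membership.Propositional using (_∈_)
open import Data.List.Membership.Propositional.Properties
  using (∈-∃++; ∈-applyUpTo⁺; ∈-applyUpTo⁻; ∈-upTo⁺; ∈-upTo⁻)
open import Data.List.Properties
  using (++-identityʳ; ∷-injective; ∷ʳ-injectiveʳ; length-++; length-applyUpTo;
         length-iterate; length-map; length-upTo; map-++; map-∘; map-applyUpTo;
         map-cong; map-injective; map-tabulate; map-upTo; reverse-map; reverse-upTo)
open import Data.List.Relation.Binary.Lex.Core using (base; this; next)
open import Data.List.Relation.Binary.Permutation.Homogeneous as Homogeneous using ()
open import Data.List.Relation.Binary.Permutation.Propositional
  using (_↭_; ↭-sym; ↭-trans; ↭-reflexive; ↭-refl; ↭-prep; ↭⇒↭ₛ; module PermutationReasoning)
open import Data.List.Relation.Binary.Permutation.Propositional.Properties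
  using (drop-∷; ∈-resp-↭; ↭-length; ∷↭∷ʳ; map⁺) renaming (shift to ↭-shift)
open import Data.List.Relation.Binary.Pointwise as Pointwise using (Pointwise-≡⇒≡)
open import Data.List.Relation.Binary.Subset.Propositional using (_⊆_)
open import Data.List.Relation.Unary.All as All using (All; []; _∷_)
import Data.List.Relation.Unary.All.Properties as All
open import Data.List.Relation.Unary.AllPairs using (AllPairs; []; _∷_)
open import Data.List.Relation.Unary.Any using (here; there)
open import Data.List.Relation.Unary.Linked using (Linked; [])
import Data.List.Relation.Unary.Linked.Properties as Linked
open import Data.List.Relation.Unary.Sorted.TotalOrder.Properties
  using (↗↭↗⇒≋; Sorted⇒AllPairs)
open import Data.List.Relation.Unary.Unique.Propositional using (Unique)
import Data.List.Relation.Unary.Unique.Propositional.Properties as Unique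
open import Data.List.Sort as Sort using ()
open import Data.Maybe.Base using (just)
open import Data.Nat.Base
open import Data.Nat.Coprimality using (coprime-divisor)
open import Data.Nat.Divisibility
  using (_∣_; 0∣⇒≡0; ∣1⇒≡1; ∣-reflexive; ∣-trans; ∣m+n∣m⇒∣n; ∣m⇒∣m*n; ∣n∣m%n⇒∣m)
open import Data.Nat.DivMod
open import Data.Nat.GeneralisedArithmetic using () renaming (iterate to iter)
open import Data.Nat.Primality using (Prime; prime; composite)
open import Data.Nat.Properties
open import Data.Nat.Tactic.RingSolver using (solve-∀)
open import Data.Product.Base using (Σ-syntax; _×_; _,_; ∃-syntax; proj₁; proj₂)
open import Data.Sum.Base using (_⊎_; inj₁; inj₂)
open import Function.Base using (_∘_; id)
open import Function.Bundles using (_⇔_; mk⇔; Equivalence)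
open import Relation.Binary.Bundles using (DecTotalOrder)
open import Relation.Binary.Definitions using (tri<; tri≈; tri>)
open import Relation.Binary.PropositionalEquality
open import Relation.Nullary using (contradiction)

-- Lists

-- Each element of `xs` is cut out of `ys` in turn; uniqueness ensures that the later ones survive
-- the cut. The next two lemmas count with this.
unique-⊆⇒↭-++ : ∀ {A : Set} {xs ys : List A} → Unique xs → xs ⊆ ys →
                ∃[ zs ] ys ↭ xs ++ zs
unique-⊆⇒↭-++ {ys = ys} [] _ = ys , ↭-refl
unique-⊆⇒↭-++ {xs = x ∷ xs} {ys} (x∉xs ∷ xs!) xs⊆ys
  with as , bs , refl ← ∈-∃++ (xs⊆ys (here refl)) =
  let zs , p = unique-⊆⇒↭-++ xs! xs⊆ in zs , ↭-trans q (↭-prep x p)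
  where
  q : as ++ x ∷ bs ↭ x ∷ as ++ bs
  q = ↭-shift x as bs
  xs⊆ : xs ⊆ as ++ bs
  xs⊆ y∈xs with ∈-resp-↭ q (xs⊆ys (there y∈xs))
  ... | here y≡x  = contradiction (sym y≡x) (All.lookup x∉xs y∈xs)
  ... | there y∈ = y∈

unique-⊆⇒length-≤ : ∀ {A : Set} {xs ys : List A} → Unique xs → xs ⊆ ys →
                    length xs ≤ length ys
unique-⊆⇒length-≤ {xs = xs} {ys} xs! xs⊆ys =
  let zs , p = unique-⊆⇒↭-++ xs! xs⊆ys in begin
    length xs               ≤⟨ m≤m+n _ _ ⟩
    length xs + length zs   ≡⟨ length-++ xs ⟨
    length (xs ++ zs)       ≡⟨ ↭-length p ⟨
    length ys               ∎
  where open ≤-Reasoning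

unique-⊆⇒↭ : ∀ {A : Set} {xs ys : List A} → Unique xs → xs ⊆ ys →
             length xs ≡ length ys → ys ↭ xs
unique-⊆⇒↭ {xs = xs} xs! xs⊆ys eq with unique-⊆⇒↭-++ xs! xs⊆ys
... | []     , p = subst (_ ↭_) (++-identityʳ xs) p
... | z ∷ zs , p = contradiction
  (trans eq (trans (↭-length p) (length-++ xs))) (m≢1+m+n _ ∘ λ e → trans e (+-suc _ _))

iter-+ : ∀ {A : Set} (f : A → A) x m n → iter f x (m + n) ≡ iter f (iter f x m) n
iter-+ f x zero    n = refl
iter-+ f x (suc m) n = iter-+ f (f x) m n

iter-suc : ∀ {A : Set} (f : A → A) x n → iter f x (suc n) ≡ f (iter f x n)
iter-suc f x zero    = refl
iter-suc f x (suc n) = iter-suc f (f x) n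

iterate≡applyUpTo : ∀ {A : Set} (f : A → A) x n → iterate f x n ≡ applyUpTo (iter f x) n
iterate≡applyUpTo f x zero    = refl
iterate≡applyUpTo f x (suc n) = cong (x ∷_) (iterate≡applyUpTo f (f x) n)

map-iterate : ∀ {A : Set} (f : A → A) x n → map f (iterate f x n) ≡ iterate f (f x) n
map-iterate f x zero    = refl
map-iterate f x (suc n) = cong (f x ∷_) (map-iterate f (f x) n)

applyUpTo-cong : ∀ {A : Set} {f g : ℕ → A} n → (∀ {i} → i < n → f i ≡ g i) →
                 applyUpTo f n ≡ applyUpTo g n
applyUpTo-cong zero    eq = refl
applyUpTo-cong (suc n) eq = cong₂ _∷_ (eq z<s) (applyUpTo-cong n (eq ∘ s<s))

applyUpTo-+ : ∀ {A : Set} (f : ℕ → A) m n →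
              applyUpTo f (m + n) ≡ applyUpTo f m ++ applyUpTo (f ∘ (m +_)) n
applyUpTo-+ f zero    n = refl
applyUpTo-+ f (suc m) n = cong (f 0 ∷_) (applyUpTo-+ (f ∘ suc) m n)

tabulate≡applyUpTo : ∀ {A : Set} (f : ℕ → A) n → tabulate {n = n} (f ∘ toℕ) ≡ applyUpTo f n
tabulate≡applyUpTo f zero    = refl
tabulate≡applyUpTo f (suc n) = cong (f 0 ∷_) (tabulate≡applyUpTo (f ∘ suc) n)

applyUpTo-injective : ∀ {A : Set} (f g : ℕ → A) n → applyUpTo f n ≡ applyUpTo g n →
                      ∀ {i} → i < n → f i ≡ g i
applyUpTo-injective f g (suc n) eq {zero}  _         = proj₁ (∷-injective eq)
applyUpTo-injective f g (suc n) eq {suc i} (s≤s i<n) =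
  applyUpTo-injective (f ∘ suc) (g ∘ suc) n (proj₂ (∷-injective eq)) i<n

applyUpTo-AllPairs⁻ : ∀ {A : Set} {_∼_ : A → A → Set} (f : ℕ → A) n →
                      AllPairs _∼_ (applyUpTo f n) → ∀ {i j} → i < j → j < n → f i ∼ f j
applyUpTo-AllPairs⁻ f (suc n) (f0∼ ∷ _)  {zero}  {suc j} _         (s≤s j<n) =
  All.applyUpTo⁻ (f ∘ suc) n f0∼ j<n
applyUpTo-AllPairs⁻ f (suc n) (_ ∷ rest) {suc i} {suc j} (s≤s i<j) (s≤s j<n) =
  applyUpTo-AllPairs⁻ (f ∘ suc) n rest i<j j<n

last-∷ʳ : ∀ {A : Set} (xs : List A) x → last (xs ∷ʳ x) ≡ just x
last-∷ʳ []           x = refl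
last-∷ʳ (_ ∷ [])     x = refl
last-∷ʳ (_ ∷ y ∷ xs) x = last-∷ʳ (y ∷ xs) x

mapMaybe-last⁺ : ∀ {A : Set} (f : ℕ → List A) (g : ℕ → A) n →
                 (∀ {i} → i < n → last (f i) ≡ just (g i)) →
                 mapMaybe last (applyUpTo f n) ≡ applyUpTo g n
mapMaybe-last⁺ f g zero    eq = refl
mapMaybe-last⁺ f g (suc n) eq rewrite eq {0} z<s =
  cong (g 0 ∷_) (mapMaybe-last⁺ (f ∘ suc) (g ∘ suc) n (eq ∘ s<s))

-- Nonempty lists all contribute a last entry, so places in the two lists match. Past the end, `h`
-- takes the default value `[]`.
mapMaybe-last⁻ : ∀ {A : Set} (g : ℕ → A) n {xss : List (List A)} → All (_≢ []) xss →
                 mapMaybe last xss ≡ applyUpTo g n →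
                 Σ[ h ∈ (ℕ → List A) ] xss ≡ applyUpTo (λ i → h i ∷ʳ g i) n
mapMaybe-last⁻ g zero    []              eq = (λ _ → []) , refl
mapMaybe-last⁻ g n {xs ∷ xss} (xs≢[] ∷ xss≢[]) eq with initLast xs
... | []       = contradiction refl xs≢[]
... | ys ∷ʳ′ y rewrite last-∷ʳ ys y with n
...   | suc n with refl , eq′ ← ∷-injective eq
              with h , refl ← mapMaybe-last⁻ (g ∘ suc) n xss≢[] eq′ =
        (λ { zero → ys ; (suc i) → h i }) , refl

-- Permutations of an initial segment of ℕ

module FinitePermutation (N : ℕ) (s : ℕ → ℕ)
  (s< : ∀ {i} → i < N → s i < N)
  (s-injective : ∀ {i j} → i < N → j < N → s i ≡ s j → i ≡ j) where

  applyUpTo-↭ : applyUpTo s N ↭ upTo N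
  applyUpTo-↭ = ↭-sym (unique-⊆⇒↭
    (Unique.applyUpTo⁺₁ s N λ i<j j<N eq →
      <⇒≢ i<j (s-injective (<-trans i<j j<N) j<N eq))
    (λ x∈ → let i , i<N , eq = ∈-applyUpTo⁻ s x∈ in
      subst (_∈ upTo N) (sym eq) (∈-upTo⁺ (s< i<N)))
    (trans (length-applyUpTo s N) (sym (length-upTo N))))

  iter< : ∀ {i} j → i < N → iter s i j < N
  iter< zero    i<N = i<N
  iter< (suc j) i<N = iter< j (s< i<N)

  iter-injective : ∀ {i i′} j → i < N → i′ < N → iter s i j ≡ iter s i′ j → i ≡ i′
  iter-injective zero    _   _    eq = eq
  iter-injective (suc j) i<N i′<N eq =
    s-injective i<N i′<N (iter-injective j (s< i<N) (s< i′<N) eq)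

  -- The second alternative accommodates negative exponents: it places `i` on the backward orbit of
  -- 0.
  Reachable : Set
  Reachable = ∀ {i} → i < N → ∃[ j ] (iter s 0 j ≡ i ⊎ iter s i j ≡ 0)

  module Cyclic (0<N : 0 < N) (reach : Reachable) where

    -- By the pigeonhole principle two of the iterates with exponents 0, ..., N agree, say at `a` <
    -- `b`; injectivity cancels the first `a` steps. The form `suc d` keeps the period positive, so
    -- that one can reduce modulo it.
    period : ∃[ d ] (suc d ≤ N × iter s 0 (suc d) ≡ 0)
    period = d , d<N , iter-injective a (iter< (suc d) 0<N) 0<N (begin
      iter s (iter s 0 (suc d)) a   ≡⟨ iter-+ s 0 (suc d) a ⟨
      iter s 0 (suc d + a)          ≡⟨ cong (iter s 0) (trans (sym (+-suc d a)) (m∸n+n≡m a<b)) ⟩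
      iter s 0 b                    ≡⟨ Fin.fromℕ<-injective _ _ _ _ (proj₂ (proj₂ (proj₂ collision))) ⟨
      iter s 0 a                    ∎)
      where
      open ≡-Reasoning
      collision = Fin.pigeonhole (n<1+n N) (λ j → fromℕ< (iter< (toℕ j) 0<N))
      a = toℕ (proj₁ collision)
      b = toℕ (proj₁ (proj₂ collision))
      a<b : a < b
      a<b = proj₁ (proj₂ (proj₂ collision))
      d = b ∸ suc a
      d<N : suc d ≤ N
      d<N = ≤-trans (∸-monoʳ-< z<s a<b) (s≤s⁻¹ (Fin.toℕ<n (proj₁ (proj₂ collision))))

    iter-*-period : ∀ {d} → iter s 0 d ≡ 0 → ∀ q → iter s 0 (q * d) ≡ 0
    iter-*-period     eq zero    = refl
    iter-*-period {d} eq (suc q) = trans (iter-+ s 0 d (q * d))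
      (trans (cong (λ i → iter s i (q * d)) eq) (iter-*-period eq q))

    upTo⊆orbit : ∀ d → iter s 0 (suc d) ≡ 0 → upTo N ⊆ iterate s 0 (suc d)
    upTo⊆orbit d eq {i} i∈ = forward (reach i<N)
      where
      i<N = ∈-upTo⁻ i∈
      reduce : ∀ j → iter s 0 j ≡ iter s 0 (j % suc d)
      reduce j = begin
        iter s 0 j
          ≡⟨ cong (iter s 0) (trans (m≡m%n+[m/n]*n j (suc d)) (+-comm (j % suc d) _)) ⟩
        iter s 0 (j / suc d * suc d + j % suc d)
          ≡⟨ iter-+ s 0 (j / suc d * suc d) _ ⟩
        iter s (iter s 0 (j / suc d * suc d)) (j % suc d)
          ≡⟨ cong (λ i → iter s i (j % suc d)) (iter-*-period eq (j / suc d)) ⟩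
        iter s 0 (j % suc d) ∎
        where open ≡-Reasoning
      ∈-orbit : ∀ j → iter s 0 j ≡ i → i ∈ iterate s 0 (suc d)
      ∈-orbit j j↦i = subst₂ _∈_ (trans (sym (reduce j)) j↦i)
        (sym (iterate≡applyUpTo s 0 (suc d))) (∈-applyUpTo⁺ (iter s 0) (m%n<n j (suc d)))
      forward : ∃[ j ] (iter s 0 j ≡ i ⊎ iter s i j ≡ 0) → i ∈ iterate s 0 (suc d)
      forward (j , inj₁ 0↦i) = ∈-orbit j 0↦i
      -- As `j * d + j` is a multiple of the period, the iterate of 0 at `j * d` reaches 0 after `j`
      -- more steps, just as `i` does; injectivity identifies the two.
      forward (j , inj₂ i↦0) = ∈-orbit (j * d)
        (iter-injective j (iter< (j * d) 0<N) i<N (begin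
          iter s (iter s 0 (j * d)) j   ≡⟨ iter-+ s 0 (j * d) j ⟨
          iter s 0 (j * d + j)          ≡⟨ cong (iter s 0) (trans (+-comm _ j) (sym (*-suc j d))) ⟩
          iter s 0 (j * suc d)          ≡⟨ iter-*-period eq j ⟩
          0                             ≡⟨ i↦0 ⟨
          iter s i j                    ∎))
        where open ≡-Reasoning

    cyclic : iter s 0 N ≡ 0 × iterate s 0 N ↭ upTo N
    cyclic with d , d<N , eq ← period
           -- The orbit covers all N indices, so the period is at least N; being at most N, it is N.
           with refl ← ≤-antisym d<N (subst₂ _≤_ (length-upTo N) (length-iterate s 0 (suc d))
                         (unique-⊆⇒length-≤ (Unique.upTo⁺ N) (upTo⊆orbit d eq))) =
      eq , unique-⊆⇒↭ (Unique.upTo⁺ N) (upTo⊆orbit d eq)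
             (trans (length-upTo N) (sym (length-iterate s 0 N)))

-- Words and their sorted matrices

length-rotation : ∀ {k} (u : Word k) m {v} → v ∈ iterate shift u m → length v ≡ length u
length-rotation u (suc m) (here refl) = refl
length-rotation u (suc m) (there v∈)  = trans (length-rotation (shift u) m v∈) (length-shift u)

shift-injective : ∀ {k} {u v : Word k} → shift u ≡ shift v → u ≡ v
shift-injective {u = u} {v} eq with initLast u | initLast v
... | []      | []      = refl
... | _ ∷ʳ′ _ | _ ∷ʳ′ _ with refl , refl ← ∷-injective eq = refl

iter-shift-injective : ∀ {k} {u v : Word k} n → iter shift u n ≡ iter shift v n → u ≡ v
iter-shift-injective zero    eq = eq
iter-shift-injective (suc n) eq = shift-injective (iter-shift-injective n eq)

module _ {k : ℕ} where

  open DecTotalOrder (lexOrder k) public using ()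
    renaming (_≤_ to _≤ʷ_; refl to ≤ʷ-refl; antisym to ≤ʷ-antisym)

  private
    variable
      c d : Fin k
      u v : Word k

  head-<⇒≤ʷ : c Fin.< d → c ∷ u ≤ʷ d ∷ v
  head-<⇒≤ʷ c<d = this (<⇒≤ c<d , λ c≡d → <⇒≢ c<d (cong toℕ c≡d))

  -- Equal lengths exclude the case where `v` runs out first and `u` would be the larger word.
  init-≤ʷ : ∀ u v → length u ≡ length v → u ∷ʳ c ≤ʷ v ∷ʳ d → u ≤ʷ v
  init-≤ʷ []      []      _  _               = base _
  init-≤ʷ (x ∷ u) (y ∷ v) eq (this x<y)      = this x<y
  init-≤ʷ (x ∷ u) (y ∷ v) eq (next x≈y u≤v) = next x≈y (init-≤ʷ u v (suc-injective eq) u≤v)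

  -- A sorted arrangement is unique, so exhibiting one determines the matrix.
  sortWords-unique : ∀ {us vs : List (Word k)} → Linked _≤ʷ_ vs → us ↭ vs → sortWords us ≡ vs
  sortWords-unique {us} {vs} vs↗ us↭vs = trans (sortWords-cong us↭vs)
    (Pointwise-≡⇒≡ (Pointwise.map Pointwise-≡⇒≡
      (↗↭↗⇒≋ totalOrder (sort-↗ vs) vs↗ (Homogeneous.map Eq.reflexive (↭⇒↭ₛ (sort-↭ vs))))))
    where
    open DecTotalOrder (lexOrder k) using (totalOrder; module Eq)
    open Sort (lexOrder k) using (sort-↭; sort-↗)

-- In the application, s is the inverse of the standard permutation of the word
-- β 0 β 1 ⋯ β (N − 1).
module StandardPermutation {k N : ℕ} (0<N : 0 < N) (β : ℕ → Fin k) (s : ℕ → ℕ)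
  (s< : ∀ {i} → i < N → s i < N)
  (s-injective : ∀ {i j} → i < N → j < N → s i ≡ s j → i ≡ j)
  (βs-mono : ∀ {i j} → i < j → j < N →
             β (s i) Fin.< β (s j) ⊎ (β (s i) ≡ β (s j) × s i < s j)) where

  open FinitePermutation N s s< s-injective

  -- If each row is the shift of the row at its image under `s`, then the first letter of row `i` is
  -- the last letter of row `s i`, namely `β (s i)`; the later letters follow the orbit. The length
  -- `m` is free for induction.
  row : ℕ → ℕ → Word k
  row m i = map (β ∘ s) (iterate s i m)

  -- `βs-mono` compares the first letters; on a tie `s` preserves the order, and induction compares
  -- the tails.
  row-mono : ∀ m {i j} → i ≤ j → j < N → row m i ≤ʷ row m j
  row-mono zero    i≤j j<N = base _
  row-mono (suc m) i≤j j<N with m≤n⇒m<n∨m≡n i≤j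
  ... | inj₂ refl = ≤ʷ-refl
  ... | inj₁ i<j with βs-mono i<j j<N
  ...   | inj₁ c<d          = head-<⇒≤ʷ c<d
  ...   | inj₂ (c≡d , si<sj) = next c≡d (row-mono m (<⇒≤ si<sj) (s< j<N))

  row-∷ʳ : ∀ m {i} → iter s i (suc m) ≡ i → row (suc m) i ≡ row m i ∷ʳ β i
  row-∷ʳ m {i} eq = begin
    map (β ∘ s) (iterate s i (suc m))         ≡⟨ cong (map _) (iterate-∷ʳ s i m) ⟩
    map (β ∘ s) (iterate s i m ∷ʳ iter s i m) ≡⟨ map-++ _ (iterate s i m) _ ⟩
    row m i ∷ʳ β (s (iter s i m))             ≡⟨ cong (λ j → row m i ∷ʳ β j) (trans (sym (iter-suc s i m)) eq) ⟩
    row m i ∷ʳ β i                            ∎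
    where open ≡-Reasoning

  last-row : ∀ m {i} → 0 < m → iter s i m ≡ i → last (row m i) ≡ just (β i)
  last-row (suc m) {i} _ eq = trans (cong last (row-∷ʳ m eq)) (last-∷ʳ (row m i) (β i))

  shift-row : ∀ m {i} → 0 < m → iter s i m ≡ i → shift (row m (s i)) ≡ row m i
  shift-row (suc m) {i} _ eq = trans
    (cong shift (row-∷ʳ m (trans (iter-suc s (s i) m) (cong s eq))))
    (shift-∷ʳ (row m (s i)) (β (s i)))

  iter-fixed : ∀ {i} j → iter s i N ≡ i → iter s (iter s i j) N ≡ iter s i j
  iter-fixed {i} j eq = begin
    iter s (iter s i j) N ≡⟨ iter-+ s i j N ⟨
    iter s i (j + N)      ≡⟨ cong (iter s i) (+-comm j N) ⟩
    iter s i (N + j)      ≡⟨ iter-+ s i N j ⟩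
    iter s (iter s i N) j ≡⟨ cong (λ x → iter s x j) eq ⟩
    iter s i j            ∎
    where open ≡-Reasoning

  -- Shifting walks the orbit backwards, from the `j`-th iterate down to `s i`, whence a permutation
  -- and not an equality.
  iterate-shift-row : ∀ {i} j → iter s i N ≡ i →
    iterate shift (row N (iter s i j)) j ↭ map (row N) (iterate s (s i) j)
  iterate-shift-row     zero    eq = ↭-refl
  iterate-shift-row {i} (suc j) eq = ↭-trans
    (↭-prep _ (↭-trans (↭-reflexive (cong (λ u → iterate shift u j)
        (trans (cong (shift ∘ row N) (iter-suc s i j)) (shift-row N 0<N (iter-fixed j eq)))))
      (iterate-shift-row j eq)))
    (map⁺ (row N) (↭-trans (∷↭∷ʳ _ _) (↭-reflexive (sym (iterate-∷ʳ s (s i) j)))))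

  cyclic⇒bwt : iter s 0 N ≡ 0 → iterate s 0 N ↭ upTo N → bwt (row N 0) ≡ applyUpTo β N
  cyclic⇒bwt eq orbit = trans
    (cong (mapMaybe last) (sortWords-unique
      (Linked.applyUpTo⁺₁ (row N) N (λ i<N → row-mono N (n≤1+n _) i<N)) shifts-↭))
    (mapMaybe-last⁺ (row N) β N (last-row N 0<N ∘ fixed))
    where
    fixed : ∀ {i} → i < N → iter s i N ≡ i
    fixed i<N with j , _ , refl ← ∈-applyUpTo⁻ (iter s 0)
      (subst (_ ∈_) (iterate≡applyUpTo s 0 N) (∈-resp-↭ (↭-sym orbit) (∈-upTo⁺ i<N))) =
      iter-fixed j eq
    rotated : iterate s (s 0) N ↭ iterate s 0 N
    rotated = drop-∷ (↭-trans
      (↭-reflexive (trans (iterate-∷ʳ s 0 N) (cong (iterate s 0 N ∷ʳ_) eq)))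
      (↭-sym (∷↭∷ʳ 0 (iterate s 0 N))))
    shifts-↭ : shifts (row N 0) ↭ applyUpTo (row N) N
    shifts-↭ =
      -- The starting index 0 is rewritten as its own N-th iterate, so that the backward walk can
      -- begin there.
      ↭-trans (↭-reflexive (cong₂ (λ i m → iterate shift (row N i) m) (sym eq)
        (trans (length-map _ (iterate s 0 N)) (length-iterate s 0 N)))) (
      ↭-trans (iterate-shift-row N eq) (
      ↭-trans (map⁺ (row N) (↭-trans rotated orbit))
      (↭-reflexive (map-upTo (row N) N))))

  -- Recovering the action of `s` from a given matrix

  module _ (β-adjacent : ∀ {i} → suc i < N → β i ≢ β (suc i))
           {w : Word k} (bwt≡ : bwt w ≡ applyUpTo β N) where

    private
      sort-↭ : sortWords (shifts w) ↭ shifts w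
      sort-↭ = Sort.sort-↭ (lexOrder k) (shifts w)

      length-row : ∀ {v} → v ∈ sortWords (shifts w) → length v ≡ length w
      length-row v∈ = length-rotation w (length w) (∈-resp-↭ sort-↭ v∈)

      w≢[] : w ≢ []
      -- The matrix of the empty word has no rows, whereas N letters are prescribed.
      w≢[] refl = <-irrefl (trans (cong (length ∘ mapMaybe last) (sym (sortWords-unique {us = []} [] ↭-refl)))
        (trans (cong length bwt≡) (length-applyUpTo β N))) 0<N

      row≢[] : ∀ {v} → v ∈ sortWords (shifts w) → v ≢ []
      row≢[] v∈ refl = w≢[] (length≡0⇒≡[] w (sym (length-row v∈)))
        where
        length≡0⇒≡[] : ∀ (u : Word k) → length u ≡ 0 → u ≡ []
        length≡0⇒≡[] [] _ = refl

      splitting = mapMaybe-last⁻ β N (All.tabulate row≢[]) bwt≡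

      U : ℕ → Word k
      U = proj₁ splitting

      R : ℕ → Word k
      R i = U i ∷ʳ β i

      rows≡ : sortWords (shifts w) ≡ applyUpTo R N
      rows≡ = proj₂ splitting

      R-∈ : ∀ {i} → i < N → R i ∈ sortWords (shifts w)
      R-∈ {i} i<N = subst (R i ∈_) (sym rows≡) (∈-applyUpTo⁺ R i<N)

      R-sorted : AllPairs _≤ʷ_ (applyUpTo R N)
      R-sorted = subst (AllPairs _≤ʷ_) rows≡
        (Sorted⇒AllPairs totalOrder (Sort.sort-↗ (lexOrder k) (shifts w)))
        where open DecTotalOrder (lexOrder k) using (totalOrder)

      R-mono : ∀ {i j} → i < j → j < N → R i ≤ʷ R j
      R-mono = applyUpTo-AllPairs⁻ R N R-sorted

      length-U : ∀ {i j} → i < N → j < N → length (U i) ≡ length (U j)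
      length-U {i} {j} i<N j<N = +-cancelʳ-≡ 1 _ _ (begin
        length (U i) + 1 ≡⟨ length-++ (U i) ⟨
        length (R i)     ≡⟨ length-row (R-∈ i<N) ⟩
        length w         ≡⟨ length-row (R-∈ j<N) ⟨
        length (R j)     ≡⟨ length-++ (U j) ⟩
        length (U j) + 1 ∎)
        where open ≡-Reasoning

      -- This is `shift (R i)` in computed form.
      shifted : ℕ → Word k
      shifted i = β i ∷ U i

      -- Rows ending in the same letter keep their order under shift.
      shifted-↗ : Linked _≤ʷ_ (applyUpTo (shifted ∘ s) N)
      shifted-↗ = Linked.applyUpTo⁺₁ (shifted ∘ s) N step
        where
        step : ∀ {i} → suc i < N → shifted (s i) ≤ʷ shifted (s (suc i))
        step {i} i<N with βs-mono (n<1+n i) i<N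
        ... | inj₁ c<d           = head-<⇒≤ʷ c<d
        ... | inj₂ (c≡d , si<sj) = next c≡d (init-≤ʷ (U (s i)) (U (s (suc i)))
          (length-U (s< (<-trans (n<1+n i) i<N)) (s< i<N)) (R-mono si<sj (s< i<N)))

      map-shift-shifts : map shift (shifts w) ↭ shifts w
      map-shift-shifts = ↭-trans (↭-reflexive (trans (map-iterate shift w (length w))
        (cong (iterate shift (shift w)) (sym (length-shift w))))) (shifts-shift w)

      -- The multiset of shifts is closed under `shift`, and `s` merely permutes the indices.
      shifts-↭-shifted : shifts w ↭ applyUpTo (shifted ∘ s) N
      shifts-↭-shifted = begin
        shifts w                         ↭⟨ map-shift-shifts ⟨
        map shift (shifts w)             ↭⟨ map⁺ shift sort-↭ ⟨
        map shift (sortWords (shifts w)) ≡⟨ cong (map shift) rows≡ ⟩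
        map shift (applyUpTo R N)        ≡⟨ cong (map shift) (map-upTo R N) ⟨
        map shift (map R (upTo N))       ≡⟨ map-∘ (upTo N) ⟨
        map (shift ∘ R) (upTo N)         ≡⟨ map-cong (λ i → shift-∷ʳ (U i) (β i)) (upTo N) ⟩
        map shifted (upTo N)             ↭⟨ map⁺ shifted applyUpTo-↭ ⟨
        map shifted (applyUpTo s N)      ≡⟨ map-applyUpTo s shifted N ⟩
        applyUpTo (shifted ∘ s) N        ∎
        where open PermutationReasoning

      -- The matrix and the list of shifted rows in the order given by `s` are both sorted
      -- arrangements of the same multiset, hence equal row by row.
      R-shift : ∀ {i} → i < N → R i ≡ shift (R (s i))
      R-shift {i} i<N = trans
        (applyUpTo-injective R (shifted ∘ s) N
          (trans (sym rows≡) (sortWords-unique shifted-↗ shifts-↭-shifted)) i<N)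
        (sym (shift-∷ʳ (U (s i)) (β (s i))))

      R-iter : ∀ c {i} → i < N → R i ≡ iter shift (R (iter s i c)) c
      R-iter zero    i<N = refl
      R-iter (suc c) i<N = trans (R-shift i<N) (trans (cong shift (R-iter c (s< i<N)))
        (sym (iter-suc shift _ c)))

      -- Equal rows would be equal to all rows between them, in particular to an
      -- adjacent one, which has another last letter.
      R-≢ : ∀ {i j} → i < j → j < N → R i ≢ R j
      R-≢ {i} {j} i<j j<N eq = β-adjacent 1+i<N (∷ʳ-injectiveʳ (U i) (U (suc i)) Ri≡R1+i)
        where
        1+i<N : suc i < N
        1+i<N = ≤-<-trans i<j j<N
        R1+i≤Rj : R (suc i) ≤ʷ R j
        R1+i≤Rj with m≤n⇒m<n∨m≡n i<j
        ... | inj₁ 1+i<j = R-mono 1+i<j j<N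
        ... | inj₂ refl  = ≤ʷ-refl
        Ri≡R1+i : R i ≡ R (suc i)
        Ri≡R1+i = Pointwise-≡⇒≡ (≤ʷ-antisym (R-mono (n<1+n i) 1+i<N)
          (subst (R (suc i) ≤ʷ_) (sym eq) R1+i≤Rj))

      R-injective : ∀ {i j} → i < N → j < N → R i ≡ R j → i ≡ j
      R-injective {i} {j} i<N j<N eq with <-cmp i j
      ... | tri< i<j _ _ = contradiction eq (R-≢ i<j j<N)
      ... | tri≈ _ i≡j _ = i≡j
      ... | tri> _ _ j<i = contradiction (sym eq) (R-≢ j<i i<N)

      rotation : ∀ {i} → i < N → ∃[ a ] (a < length w × R i ≡ iter shift w a)
      rotation {i} i<N = ∈-applyUpTo⁻ (iter shift w)
        (subst (R i ∈_) (iterate≡applyUpTo shift w (length w)) (∈-resp-↭ sort-↭ (R-∈ i<N)))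

    -- Both `R i` and `R 0` are rotations of `w`, so `c` shifts lead from `R i` to `R 0`. They also
    -- lead there from the row at the `c`-th iterate of 0; cancelling them and using that rows are
    -- distinct identifies the indices.
    bwt⇒transitive : ∀ {i} → i < N → ∃[ c ] iter s 0 c ≡ i
    bwt⇒transitive {i} i<N
      with a , a<m , Ri≡ ← rotation i<N | b , _ , R0≡ ← rotation 0<N =
      c , sym (R-injective i<N (iter< c 0<N) (iter-shift-injective c (begin
        iter shift (R i) c                      ≡⟨ cong (λ v → iter shift v c) Ri≡ ⟩
        iter shift (iter shift w a) c           ≡⟨ iter-+ shift w a c ⟨
        iter shift w (a + c)                    ≡⟨ cong (iter shift w) (trans (sym (+-assoc a _ b))
                                                     (cong (_+ b) (m+[n∸m]≡n (<⇒≤ a<m)))) ⟩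
        iter shift w (length w + b)             ≡⟨ iter-+ shift w (length w) b ⟩
        iter shift (iter shift w (length w)) b  ≡⟨ cong (λ v → iter shift v b) (shift-length w) ⟩
        iter shift w b                          ≡⟨ R0≡ ⟨
        R 0                                     ≡⟨ R-iter c 0<N ⟩
        iter shift (R (iter s 0 c)) c           ∎)))
      where
      open ≡-Reasoning
      -- Complete the turn from rotation `a` back to `w`, then go on to rotation `b`.
      c = (length w ∸ a) + b

-- Remainders

%-*-% : ∀ m n p .{{_ : NonZero p}} → (m % p * n) % p ≡ (m * n) % p
%-*-% m n p = begin
  (m % p * n) % p               ≡⟨ %-distribˡ-* (m % p) n p ⟩
  (m % p % p * (n % p)) % p     ≡⟨ cong (λ r → (r * (n % p)) % p) (m%n%n≡m%n m p) ⟩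
  (m % p * (n % p)) % p         ≡⟨ %-distribˡ-* m n p ⟨
  (m * n) % p                   ∎
  where open ≡-Reasoning

%-suc-% : ∀ m p .{{_ : NonZero p}} → suc (m % p) % p ≡ suc m % p
%-suc-% m p = begin
  suc (m % p) % p               ≡⟨ %-distribˡ-+ 1 (m % p) p ⟩
  (1 % p + m % p % p) % p       ≡⟨ cong (λ r → (1 % p + r) % p) (m%n%n≡m%n m p) ⟩
  (1 % p + m % p) % p           ≡⟨ %-distribˡ-+ 1 m p ⟨
  suc m % p                     ∎
  where open ≡-Reasoning

-- The word αⁿ and multiplication by k modulo kn + 1

module _ (k : ℕ) .{{_ : NonZero k}} where

  -- The letter k - 1 - (i mod k): the word α continued periodically over all of ℕ.
  β : ℕ → Fin k
  β i = Fin.opposite (i mod k)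

  toℕ-β : ∀ i → toℕ (β i) ≡ k ∸ suc (i % k)
  toℕ-β i = trans (Fin.opposite-prop (i mod k))
    (cong (λ r → k ∸ suc r) (Fin.toℕ-fromℕ< (m%n<n i k)))

  β-injective : ∀ {i j} → β i ≡ β j → i % k ≡ j % k
  β-injective {i} {j} eq = begin
    i % k                                    ≡⟨ Fin.toℕ-fromℕ< (m%n<n i k) ⟨
    toℕ (i mod k)                            ≡⟨ cong toℕ (Fin.opposite-involutive (i mod k)) ⟨
    toℕ (Fin.opposite (β i))                 ≡⟨ cong (toℕ ∘ Fin.opposite) eq ⟩
    toℕ (Fin.opposite (β j))                 ≡⟨ cong toℕ (Fin.opposite-involutive (j mod k)) ⟩
    toℕ (j mod k)                            ≡⟨ Fin.toℕ-fromℕ< (m%n<n j k) ⟩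
    j % k                                    ∎
    where open ≡-Reasoning

  β-periodic : ∀ i → β (k + i) ≡ β i
  β-periodic i = Fin.toℕ-injective (begin
    toℕ (β (k + i))        ≡⟨ toℕ-β (k + i) ⟩
    k ∸ suc ((k + i) % k)  ≡⟨ cong (λ m → k ∸ suc (m % k)) (+-comm k i) ⟩
    k ∸ suc ((i + k) % k)  ≡⟨ cong (λ r → k ∸ suc r) ([m+n]%n≡m%n i k) ⟩
    k ∸ suc (i % k)        ≡⟨ toℕ-β i ⟨
    toℕ (β i)              ∎)
    where open ≡-Reasoning

  α≡β : α k ≡ applyUpTo β k
  α≡β = map-injective Fin.toℕ-injective (begin
    map toℕ (reverse (allFin k))      ≡⟨ reverse-map toℕ (allFin k) ⟩
    reverse (map toℕ (allFin k))      ≡⟨ cong reverse (map-tabulate {n = k} id toℕ) ⟩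
    reverse (tabulate {n = k} toℕ)    ≡⟨ cong reverse (tabulate≡applyUpTo id k) ⟩
    reverse (upTo k)                  ≡⟨ reverse-upTo k ⟩
    downFrom k                        ≡⟨ applyUpTo-∸ k ⟨
    applyUpTo (λ i → k ∸ suc i) k     ≡⟨ applyUpTo-cong k (λ i<k → trans
                                           (cong (λ r → k ∸ suc r) (sym (m<n⇒m%n≡m i<k)))
                                           (sym (toℕ-β _))) ⟩
    applyUpTo (toℕ ∘ β) k             ≡⟨ map-applyUpTo β toℕ k ⟨
    map toℕ (applyUpTo β k)           ∎)
    where
    open ≡-Reasoning
    applyUpTo-∸ : ∀ m → applyUpTo (λ i → m ∸ suc i) m ≡ downFrom m
    applyUpTo-∸ zero    = refl
    applyUpTo-∸ (suc m) = cong (m ∷_) (applyUpTo-∸ m)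

  α^n≡β : ∀ n → α k ^ʷ n ≡ applyUpTo β (k * n)
  α^n≡β n = trans (go n) (cong (applyUpTo β) (*-comm n k))
    where
    go : ∀ n → α k ^ʷ n ≡ applyUpTo β (n * k)
    go zero    = refl
    go (suc n) = begin
      α k ++ α k ^ʷ n                                ≡⟨ cong₂ _++_ α≡β (go n) ⟩
      applyUpTo β k ++ applyUpTo β (n * k)           ≡⟨ cong (applyUpTo β k ++_) (applyUpTo-cong (n * k)
                                                          λ {i} _ → sym (β-periodic i)) ⟩
      applyUpTo β k ++ applyUpTo (β ∘ (k +_)) (n * k) ≡⟨ applyUpTo-+ β k (n * k) ⟨
      applyUpTo β (k + n * k)                        ∎
      where open ≡-Reasoning

  -- Equal letters would make the residues of `i` and `suc i` modulo `k` agree. Without wrap-around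
  -- they differ by one; with it the residue k - 1 would be 0, forcing k = 1.
  β-adjacent : 2 ≤ k → ∀ i → β i ≢ β (suc i)
  β-adjacent 2≤k i eq with m≤n⇒m<n∨m≡n (m%n<n i k)
  ... | inj₁ r+1<k = 1+n≢n (sym (trans r≡ (m<n⇒m%n≡m r+1<k)))
    where
    r≡ : i % k ≡ suc (i % k) % k
    r≡ = trans (β-injective eq) (sym (%-suc-% i k))
  ... | inj₂ r+1≡k = <-irrefl (trans (cong suc (sym r≡0)) r+1≡k) 2≤k
    where
    r≡0 : i % k ≡ 0
    r≡0 = trans (β-injective eq) (trans (sym (%-suc-% i k)) (trans (cong (_% k) r+1≡k) (n%n≡0 k)))

-- Keeping `p` abstract lets computations use `suc (k * n)` while the theorem speaks of `k * n + 1`.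
module Multiplication (k n p : ℕ) .{{_ : NonZero k}} .{{_ : NonZero p}}
                      (p≡ : p ≡ suc (k * n)) where

  N : ℕ
  N = k * n

  -- Multiplication by k modulo p, with i representing the residue i + 1.
  s : ℕ → ℕ
  s i = pred (suc i * k % p)

  private
    <N⇒<p : ∀ {i} → i < N → suc i < p
    <N⇒<p i<N = subst (_ <_) (sym p≡) (s<s i<N)

    -- The inverse is −n = (k − 1) n + 1, as k n ≡ −1 (mod p).
    inverse : ∃[ k⁻¹ ] (∀ {x} → x < p → (x * k % p * k⁻¹) % p ≡ x)
    inverse = k⁻¹ , λ {x} x<p → begin
      (x * k % p * k⁻¹) % p      ≡⟨ %-*-% (x * k) k⁻¹ p ⟩
      (x * k * k⁻¹) % p          ≡⟨ cong (_% p) (trans (*-assoc x k k⁻¹) (cong (x *_) k*k⁻¹≡)) ⟩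
      (x * suc (pred k * p)) % p ≡⟨ cong (_% p) (trans (*-suc x _)
                                      (cong (x +_) (sym (*-assoc x (pred k) p)))) ⟩
      (x + x * pred k * p) % p   ≡⟨ [m+kn]%n≡m%n x (x * pred k) p ⟩
      x % p                      ≡⟨ m<n⇒m%n≡m x<p ⟩
      x                          ∎
      where
      open ≡-Reasoning
      k⁻¹ : ℕ
      k⁻¹ = suc (pred k * n)
      identity : ∀ l n → suc l * suc (l * n) ≡ suc (l * suc (suc l * n))
      identity = solve-∀
      k*k⁻¹≡ : k * k⁻¹ ≡ suc (pred k * p)
      k*k⁻¹≡ = begin
        k * k⁻¹                                  ≡⟨ cong (_* k⁻¹) (suc-pred k) ⟨
        suc (pred k) * k⁻¹                       ≡⟨ identity (pred k) n ⟩
        suc (pred k * suc (suc (pred k) * n))    ≡⟨ cong (λ l → suc (pred k * suc (l * n))) (suc-pred k) ⟩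
        suc (pred k * suc (k * n))               ≡⟨ cong (λ q → suc (pred k * q)) p≡ ⟨
        suc (pred k * p)                         ∎

  -- The `pred` in `s` loses nothing: if the remainder were 0, multiplying by the inverse of `k`
  -- would give `suc i` = 0.
  suc-s : ∀ {i} → i < N → suc (s i) ≡ suc i * k % p
  suc-s {i} i<N = suc-pred _ {{≢-nonZero λ eq →
    0≢1+n (trans (sym (0%p≡0)) (trans (cong (λ r → (r * k⁻¹) % p) (sym eq)) (inv (<N⇒<p i<N))))}}
    where
    k⁻¹ = proj₁ inverse
    inv = proj₂ inverse
    0%p≡0 : 0 % p ≡ 0
    0%p≡0 = m<n⇒m%n≡m (>-nonZero⁻¹ p)

  s< : ∀ {i} → i < N → s i < N
  s< {i} i<N = s<s⁻¹ (subst₂ _<_ (sym (suc-s i<N)) p≡ (m%n<n (suc i * k) p))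

  s-injective : ∀ {i j} → i < N → j < N → s i ≡ s j → i ≡ j
  s-injective {i} {j} i<N j<N eq = suc-injective (begin
    suc i                              ≡⟨ inv (<N⇒<p i<N) ⟨
    (suc i * k % p * k⁻¹) % p          ≡⟨ cong (λ r → (r * k⁻¹) % p)
                                            (trans (sym (suc-s i<N)) (trans (cong suc eq) (suc-s j<N))) ⟩
    (suc j * k % p * k⁻¹) % p          ≡⟨ inv (<N⇒<p j<N) ⟩
    suc j                              ∎)
    where
    open ≡-Reasoning
    k⁻¹ = proj₁ inverse
    inv = proj₂ inverse

  suc-iter-s : ∀ j {i} → i < N → suc (iter s i j) ≡ (suc i * k ^ j) % p
  suc-iter-s zero {i} i<N = sym (trans (cong (_% p) (*-identityʳ (suc i))) (m<n⇒m%n≡m (<N⇒<p i<N)))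
  suc-iter-s (suc j) {i} i<N = begin
    suc (iter s (s i) j)             ≡⟨ suc-iter-s j (s< i<N) ⟩
    (suc (s i) * k ^ j) % p          ≡⟨ cong (λ r → (r * k ^ j) % p) (suc-s i<N) ⟩
    (suc i * k % p * k ^ j) % p      ≡⟨ %-*-% (suc i * k) (k ^ j) p ⟩
    (suc i * k * k ^ j) % p          ≡⟨ cong (_% p) (*-assoc (suc i) k (k ^ j)) ⟩
    (suc i * k ^ suc j) % p          ∎
    where open ≡-Reasoning

  div-mod : ∀ {i} → i < N → suc i * k ≡ suc (s i) + suc i * k / p * p
  div-mod {i} i<N = trans (m≡m%n+[m/n]*n (suc i * k) p) (cong (_+ suc i * k / p * p) (sym (suc-s i<N)))

  -- Since p ≡ 1 (mod k), reducing (i + 1) k = (s i + 1) + q p modulo k determines q.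
  toℕ-βs : ∀ {i} → i < N → toℕ (β k (s i)) ≡ suc i * k / p
  toℕ-βs {i} i<N = begin
    toℕ (β k (s i))           ≡⟨ toℕ-β k (s i) ⟩
    k ∸ suc (s i % k)         ≡⟨ cong (λ r → k ∸ suc r) s%k ⟩
    k ∸ suc (k ∸ suc q)       ≡⟨ cong (k ∸_) (+-∸-assoc 1 q<k) ⟨
    k ∸ (k ∸ q)               ≡⟨ m∸[m∸n]≡n (<⇒≤ q<k) ⟩
    q                         ∎
    where
    open ≡-Reasoning
    q = suc i * k / p
    r = k ∸ suc q
    q<k : q < k
    q<k = m<n*o⇒m/o<n (subst (suc i * k <_) (*-comm p k) (*-monoˡ-< k (<N⇒<p i<N)))
    rearrange : ∀ a q n r → a + suc (q * n) * (suc q + r) ≡ suc a + q * suc ((suc q + r) * n) + r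
    rearrange = solve-∀
    s%k : s i % k ≡ r
    s%k = begin
      -- The multiple `suc (q * n) * k` is chosen because adding it to `s i` yields `suc i * k + r`.
      s i % k                                        ≡⟨ [m+kn]%n≡m%n (s i) (suc (q * n)) k ⟨
      (s i + suc (q * n) * k) % k                    ≡⟨ cong (λ l → (s i + suc (q * n) * l) % k) k≡ ⟨
      (s i + suc (q * n) * (suc q + r)) % k          ≡⟨ cong (_% k) (rearrange (s i) q n r) ⟩
      (suc (s i) + q * suc ((suc q + r) * n) + r) % k ≡⟨ cong (λ l → (suc (s i) + q * suc (l * n) + r) % k) k≡ ⟩
      (suc (s i) + q * suc (k * n) + r) % k          ≡⟨ cong (λ l → (suc (s i) + q * l + r) % k) p≡ ⟨
      (suc (s i) + q * p + r) % k                    ≡⟨ cong (λ m → (m + r) % k) (div-mod i<N) ⟨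
      (suc i * k + r) % k                            ≡⟨ cong (_% k) (+-comm (suc i * k) r) ⟩
      (r + suc i * k) % k                            ≡⟨ [m+kn]%n≡m%n r (suc i) k ⟩
      r % k                                          ≡⟨ m<n⇒m%n≡m (∸-monoʳ-< z<s q<k) ⟩
      r                                              ∎
      where
      k≡ : suc q + r ≡ k
      k≡ = m+[n∸m]≡n q<k

  -- From `i < j` the multiples of `k` increase, so their quotients by `p` weakly increase; when the
  -- quotients agree, the remainders increase.
  βs-mono : ∀ {i j} → i < j → j < N →
            β k (s i) Fin.< β k (s j) ⊎ (β k (s i) ≡ β k (s j) × s i < s j)
  βs-mono {i} {j} i<j j<N with m≤n⇒m<n∨m≡n (/-monoˡ-≤ p (*-monoˡ-≤ k (s≤s (<⇒≤ i<j))))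
  ... | inj₁ q<q′ = inj₁ (subst₂ _<_ (sym (toℕ-βs i<N)) (sym (toℕ-βs j<N)) q<q′)
    where
    i<N = <-trans i<j j<N
  ... | inj₂ q≡q′ = inj₂ (Fin.toℕ-injective (trans (toℕ-βs i<N) (trans q≡q′ (sym (toℕ-βs j<N)))) ,
      s<s⁻¹ (+-cancelʳ-< (suc j * k / p * p) _ _ (begin-strict
        suc (s i) + suc j * k / p * p ≡⟨ cong (λ q → suc (s i) + q * p) q≡q′ ⟨
        suc (s i) + suc i * k / p * p ≡⟨ div-mod i<N ⟨
        suc i * k                     <⟨ *-monoˡ-< k (s<s i<j) ⟩
        suc j * k                     ≡⟨ div-mod j<N ⟩
        suc (s j) + suc j * k / p * p ∎)))
    where
    open ≤-Reasoning
    i<N = <-trans i<j j<N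

  -- As p = kn + 1, a divisor of `p` is coprime to `k`, so the factors `k` can be stripped off the
  -- power one by one.
  coprime-∣^ : ∀ {d} → d ∣ p → ∀ j → d ∣ k ^ j → d ≡ 1
  coprime-∣^ d∣p zero    d∣1 = ∣1⇒≡1 d∣1
  coprime-∣^ {d} d∣p (suc j) d∣  = coprime-∣^ d∣p j (coprime-divisor {n = k}
    (λ (e∣d , e∣k) → ∣1⇒≡1 (∣m+n∣m⇒∣n
      (subst (_ ∣_) (trans p≡ (+-comm 1 N)) (∣-trans e∣d d∣p)) (∣m⇒∣m*n {m = k} n e∣k)))
    d∣)

  -- The two directions of the equivalence

  module _ (2≤k : 2 ≤ k) (0<n : 0 < n) where

    private
      0<N : 0 < N
      0<N = *-mono-≤ (≤-trans (s≤s z≤n) 2≤k) 0<n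

      1<p : 1 < p
      1<p = <N⇒<p 0<N

      1%p≡1 : 1 % p ≡ 1
      1%p≡1 = m<n⇒m%n≡m 1<p

      <p⇒<N : ∀ {i} → suc i < p → i < N
      <p⇒<N i<p = s<s⁻¹ (subst (_ <_) p≡ i<p)

      iter-0-s : ∀ j → suc (iter s 0 j) ≡ k ^ j % p
      iter-0-s j = trans (suc-iter-s j 0<N) (cong (_% p) (*-identityˡ (k ^ j)))

      open StandardPermutation 0<N (β k) s s< s-injective βs-mono
      open FinitePermutation N s s< s-injective

    image⇒prime∧primitive : IsBWTImage (α k ^ʷ n) →
                            Σ[ p-prime ∈ Prime p ] IsPrimitiveRoot p p-prime k
    image⇒prime∧primitive (w , bwt≡) = p-prime , λ x → mk⇔ (to x) (from x)
      where
      transitive : ∀ {i} → i < N → ∃[ j ] iter s 0 j ≡ i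
      transitive = bwt⇒transitive (λ _ → β-adjacent k 2≤k _) (trans bwt≡ (α^n≡β k n))

      power : ∀ {i} → i < N → ∃[ j ] k ^ j % p ≡ suc i
      power i<N = let j , eq = transitive i<N in j , trans (sym (iter-0-s j)) (cong suc eq)

      p-prime : Prime p
      -- A proper divisor of `p` is itself a residue in range, hence a power of `k` modulo `p`. It
      -- then divides that power of `k` and so equals 1.
      p-prime = prime {{n>1⇒nonTrivial 1<p}} λ
        { (composite {zero} _ 0∣p) → contradiction (0∣⇒≡0 0∣p) (≢-nonZero⁻¹ p)
        ; (composite {suc i} d<p d∣p) → let j , eq = power (<p⇒<N d<p) in
            contradiction (coprime-∣^ d∣p j (∣n∣m%n⇒∣m d∣p (∣-reflexive (sym eq)))) nonTrivial⇒≢1 }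

      to : ∀ x → ∃[ i ] IsPower p k i x → 1 ≤ x × x < p
      to x (ℤ.+ i      , eq)         = subst (1 ≤_) (trans (iter-0-s i) eq) (s≤s z≤n) ,
                                     subst (_< p) eq (m%n<n (k ^ i) p)
      -- Here the product with 0 would have to be 1 modulo `p`.
      to zero    (ℤ.-[1+ i ] , x<p , eq) = contradiction
        (trans (sym (m<n⇒m%n≡m x<p)) (trans eq 1%p≡1)) λ ()
      to (suc x) (ℤ.-[1+ i ] , x<p , eq) = s≤s z≤n , x<p

      from : ∀ x → 1 ≤ x × x < p → ∃[ i ] IsPower p k i x
      from (suc x) (_ , x<p) = let j , eq = power (<p⇒<N x<p) in ℤ.+ j , eq

    primitive⇒image : (p-prime : Prime p) → IsPrimitiveRoot p p-prime k → IsBWTImage (α k ^ʷ n)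
    primitive⇒image p-prime k-generates =
      row N 0 , trans (cyclic⇒bwt (proj₁ cyclic) (proj₂ cyclic)) (sym (α^n≡β k n))
      where
      reachable : Reachable
      reachable {i} i<N with Equivalence.from (k-generates (suc i)) (s≤s z≤n , <N⇒<p i<N)
      ... | ℤ.+ j      , eq     = j , inj₁ (suc-injective (trans (iter-0-s j) eq))
      -- If `suc i` is the inverse of the power of `k` with exponent `suc j`, then `suc j`
      -- multiplications by `k` take it to the residue 1, which is index 0.
      ... | ℤ.-[1+ j ] , _ , eq = suc j , inj₂ (suc-injective
        (trans (suc-iter-s (suc j) i<N) (trans eq 1%p≡1)))
      open Cyclic 0<N reachable using (cyclic)

theorem21 : ∀ (k : ℕ) → 2 ≤ k → ∀ (n : ℕ) → 0 < n →
    IsBWTImage (α k ^ʷ n) ⇔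
    (Σ[ p-prime ∈ Prime (k * n + 1) ] IsPrimitiveRoot (k * n + 1) p-prime k)
theorem21 k 2≤k n 0<n = mk⇔ (image⇒prime∧primitive 2≤k 0<n)
  (λ (p-prime , k-generates) → primitive⇒image 2≤k 0<n p-prime k-generates)
  where
  instance
    k≢0 : NonZero k
    k≢0 = >-nonZero (≤-trans (s≤s z≤n) 2≤k)
    p≢0 : NonZero (k * n + 1)
    p≢0 = >-nonZero (m≤n+m 1 (k * n))
  open Multiplication k n (k * n + 1) (+-comm (k * n) 1)
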